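{- Let $\mathcal{P}_4$ be the set of partitions $\lambda=(\lambda_1>\cdots>\lambda_\ell)$ into distinct positive parts such that for each $1\le i<\ell$: $\lambda_i-\lambda_{i+1}\equiv2\pmod 4$ if both are odd; $\equiv0\pmod 4$ if both are even; $\equiv3\pmod 4$ if they have different parity; and the smallest part $\lambda_\ell\equiv1$ or $2\pmod 4$. Let $\mathcal{S}_4$ be the set of partitions into distinct positive parts none of which is divisible by $4$. For $n\ge0$, let $\mathcal{P}_{4,e}(n)$, $\mathcal{P}_{4,o}(n)$ be the numbers of partitions of $n$ in $\mathcal{P}_4$ with an even, respectively odd, number of parts, and $\mathcal{S}_{4,e}(n)$, $\mathcal{S}_{4,o}(n)$ the analogous numbers for $\mathcal{S}_4$. Then for every $n\ge0$, $$\mathcal{P}_{4,e}(n)-\mathcal{P}_{4,o}(n)=\mathcal{S}_{4,e}(n)-\mathcal{S}_{4,o}(n).$$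
   Context: A partition of $n$ is a partition whose parts sum to $n$; the empty partition is the unique partition of $0$. -}

module Defs where

open import Data.Nat using (ℕ; zero; suc; _+_; _%_; _≡ᵇ_)
open import Data.Bool using (Bool; true; false; _∧_; _∨_; not; if_then_else_)
open import Data.List using (List; []; _∷_; length; filter; map; _++_)
open import Data.Nat.ListAction using (sum)
open import Data.Integer using (ℤ; +_; -_) renaming (_+_ to _+ℤ_; _-_ to _-ℤ_)
open import Relation.Nullary.Decidable using (Dec)
open import Relation.Binary.PropositionalEquality using (_≡_)

-- A partition into distinct positive parts is represented as a strictly
-- decreasing list of positive naturals (λ₁ > λ₂ > ... > λ_ℓ).

sublists : List ℕ → List (List ℕ)
sublists [] = [] ∷ []
sublists (x ∷ xs) = map (x ∷_) (sublists xs) ++ sublists xs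

downFrom1 : ℕ → List ℕ
downFrom1 zero = []
downFrom1 (suc n) = suc n ∷ downFrom1 n

-- All partitions of n into distinct positive parts, each exactly once,
-- as strictly decreasing lists: sublists of [n,...,1] with sum n.
distinctPartitions : ℕ → List (List ℕ)
distinctPartitions n = filter (λ l → sum l Data.Nat.≟ n) (sublists (downFrom1 n))

isEven : ℕ → Bool
isEven k = (k % 2) ≡ᵇ 0

-- Condition on consecutive parts a > b (so a - b is a natural number d = a ∸ b).
-- Using a ∸ b is exact since a > b in strictly decreasing lists.
gapOK : ℕ → ℕ → Bool
gapOK a b with isEven a | isEven b
... | false | false = ((a Data.Nat.∸ b) % 4) ≡ᵇ 2
... | true  | true  = ((a Data.Nat.∸ b) % 4) ≡ᵇ 0
... | _     | _     = ((a Data.Nat.∸ b) % 4) ≡ᵇ 3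

-- Membership in 𝒫₄ for a partition into distinct parts (strictly decreasing list).
-- The empty partition has no smallest part; the smallest-part condition is vacuous.
inP4 : List ℕ → Bool
inP4 [] = true
inP4 (a ∷ []) = ((a % 4) ≡ᵇ 1) ∨ ((a % 4) ≡ᵇ 2)
inP4 (a ∷ b ∷ rest) = gapOK a b ∧ inP4 (b ∷ rest)

inS4 : List ℕ → Bool
inS4 [] = true
inS4 (a ∷ rest) = not ((a % 4) ≡ᵇ 0) ∧ inS4 rest

countEven : (List ℕ → Bool) → ℕ → ℕ
countEven P n = length (filter (λ l → Data.Bool._≟_ (P l ∧ isEven (length l)) true) (distinctPartitions n))

countOdd : (List ℕ → Bool) → ℕ → ℕ
countOdd P n = length (filter (λ l → Data.Bool._≟_ (P l ∧ not (isEven (length l))) true) (distinctPartitions n))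

P4e P4o S4e S4o : ℕ → ℕ
P4e = countEven inP4
P4o = countOdd inP4
S4e = countEven inS4
S4o = countOdd inS4

{-# OPTIONS --safe #-}
module Submission where

-- Write Q = q². In a partition of 𝒫₄, an odd part preceded (from below) by k odd parts is
-- ≡ 2k + 1 (mod 4) and an even part preceded by k odd parts is ≡ 2k + 2 (mod 4); conversely
-- these congruences characterise 𝒫₄. Fix the number j of odd parts, bound the parts by 2K with
-- K = 2M + j, and count with sign (-1)^ℓ. Looking at the largest part, the generating function
-- satisfies f(M, j) = (1 - q^{2K-2}) f(M - 1, j) - q^{2K-1} f(M, j - 1), which is solved by
-- f(M, j) = (-1)^j ∏_{m<M} (1 - q^{4m+2}) · q^{j²} [K choose j]_Q: this is Pascal's rule together
-- with (1 - Q^{K-j}) [K choose j]_Q = (1 - Q^K) [K-1 choose j]_Q. In the product, the first factor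
-- counts sets of parts ≡ 2 (mod 4) and the second sets of j odd parts, so as the bounds grow
-- it becomes the signed generating function of the partitions in 𝒮₄ with j odd parts.

open import Defs
open import Data.Bool using (Bool; true; false; _∧_; _∨_; not; T; if_then_else_)
import Data.Bool as Bool
open import Data.Bool.Properties using (if-float; ∧-comm; ∧-zeroʳ; ∧-identityʳ)
open import Data.Integer using (ℤ; +_; -[1+_]; -_; _-_; 0ℤ; 1ℤ; -1ℤ) renaming (_+_ to _+ℤ_; _≟_ to _≟ℤ_)
import Data.Integer.Properties as ℤ
import Data.Integer.Tactic.RingSolver as ℤ-solver
open import Data.List using (List; []; _∷_; length; filter; map; _++_)
open import Data.List.Relation.Unary.All as All using (All; []; _∷_)
open import Data.List.Relation.Unary.All.Properties using (++⁺; map⁺)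
open import Data.List.Relation.Unary.Linked using (Linked; [-]; _∷_)
open import Data.Nat using (ℕ; zero; suc; _+_; _*_; _∸_; _%_; _≡ᵇ_; _≤_; _<_; _>_; z≤n; s≤s; ⌈_/2⌉)
import Data.Nat as ℕ
import Data.Nat.Properties as ℕ
open import Data.Nat.DivMod using ([m+kn]%n≡m%n)
open import Data.Nat.ListAction using (sum)
import Data.Nat.Tactic.RingSolver as ℕ-solver
open import Function using (_∘_; mk⇔)
open import Relation.Nullary using (contradiction)
open import Relation.Nullary.Decidable using (does; does-⇔)
open import Relation.Binary.PropositionalEquality

-- Signed Gaussian binomials and the product over parts congruent to 2 mod 4.

-- Coefficients are indexed by ℤ so that multiplication by q^a is n ↦ f (n - a) without a case split.
Series : Set
Series = ℤ → ℤ

δ : Series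
δ n = if does (+ 0 ≟ℤ n) then 1ℤ else 0ℤ

shift-shift : ∀ n a b {c} → a + b ≡ c → n - + a - + b ≡ n - + c
shift-shift n a b refl = trans (lemma n (+ a) (+ b)) (cong (λ m → n - m) (sym (ℤ.pos-+ a b)))
  where
  lemma : ∀ n x y → n - x - y ≡ n - (x +ℤ y)
  lemma = ℤ-solver.solve-∀

shifts-agree : ∀ n a b c d → a + b ≡ c + d → n - + a - + b ≡ n - + c - + d
shifts-agree n a b c d eq = trans (shift-shift n a b eq) (sym (shift-shift n c d refl))

-- (-1)^j q^{j²} [K choose j]_Q, the signed generating function of the j-subsets of {1, 3, …, 2K - 1}.
O : ℕ → ℕ → Series
O K       zero    n = δ n
O zero    (suc j) n = 0ℤ
O (suc K) (suc j) n = O K (suc j) n - O K j (n - + suc (K * 2))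

O-vanish : ∀ K j n → K < j → O K j n ≡ 0ℤ
O-vanish zero    (suc j) n _ = refl
O-vanish (suc K) (suc j) n (s≤s K<j)
  rewrite O-vanish K (suc j) n (ℕ.m<n⇒m<1+n K<j) | O-vanish K j (n - + suc (K * 2)) K<j = refl

private
  regroup₁ : ∀ K j → suc (suc K * 2) + suc j * 2 ≡ suc (suc j) * 2 + suc (K * 2)
  regroup₁ = ℕ-solver.solve-∀

  regroup₂ : ∀ K j → suc (suc K * 2) + suc (j * 2) ≡ suc (suc j * 2) + suc (K * 2)
  regroup₂ = ℕ-solver.solve-∀

  regroup₃ : ∀ d j → suc (d * 2 + suc (j * 2)) ≡ (d + suc j) * 2
  regroup₃ = ℕ-solver.solve-∀

  minus-interchange : ∀ x y z w → (x - y) - (z - w) ≡ (x - z) - (y - w)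
  minus-interchange = ℤ-solver.solve-∀

-- Pascal's rule for the smallest candidate part 1 instead of the largest.
O-lower-pascal : ∀ K j n →
  O (suc K) (suc j) n ≡ O K (suc j) (n - + (suc j * 2)) - O K j (n - + suc (j * 2))
O-lower-pascal zero    zero    n = refl
O-lower-pascal zero    (suc j) n = refl
O-lower-pascal (suc K) zero    n
  rewrite O-lower-pascal K zero n
  | shifts-agree n 2 (suc (K * 2)) (suc (suc K * 2)) 0 (sym (ℕ.+-identityʳ _))
  | ℤ.+-identityʳ (n - + suc (suc K * 2))
  = lemma (O K 1 (n - + 2)) (δ (n - + 1)) (δ (n - + suc (suc K * 2)))
  where
  lemma : ∀ x y z → (x - y) - z ≡ (x - z) - y
  lemma = ℤ-solver.solve-∀
O-lower-pascal (suc K) (suc j) n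
  rewrite O-lower-pascal K (suc j) n | O-lower-pascal K j (n - + suc (suc K * 2))
  | shifts-agree n (suc (suc K * 2)) (suc j * 2) (suc (suc j) * 2) (suc (K * 2)) (regroup₁ K j)
  | shifts-agree n (suc (suc K * 2)) (suc (j * 2)) (suc (suc j * 2)) (suc (K * 2)) (regroup₂ K j)
  = minus-interchange (O K (suc (suc j)) (n - + (suc (suc j) * 2))) (O K (suc j) (n - + suc (suc j * 2)))
          (O K (suc j) (n - + (suc (suc j) * 2) - + suc (K * 2)))
          (O K j (n - + suc (suc j * 2) - + suc (K * 2)))

-- Eliminating O K (j - 1) between the two Pascal rules:
-- (1 - q^{2d}) O (K + 1) j = (1 - q^{2(K+1)}) O K j.
O-absorption : ∀ K j d n → d + j ≡ suc K →
  O (suc K) j n - O (suc K) j (n - + (d * 2)) ≡ O K j n - O K j (n - + (suc K * 2))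
O-absorption K zero    d n eq rewrite trans (sym (ℕ.+-identityʳ d)) eq = refl
O-absorption K (suc j) d n eq
  rewrite O-lower-pascal K j (n - + (d * 2))
  | shift-shift n (d * 2) (suc j * 2) (trans (sym (ℕ.*-distribʳ-+ 2 d (suc j))) (cong (_* 2) eq))
  | shift-shift n (d * 2) (suc (j * 2)) (ℕ.suc-injective (trans (regroup₃ d j) (cong (_* 2) eq)))
  = lemma (O K (suc j) n) (O K j (n - + suc (K * 2))) (O K (suc j) (n - + (suc K * 2)))
  where
  lemma : ∀ x y z → (x - y) - (z - y) ≡ x - z
  lemma = ℤ-solver.solve-∀

-- Multiplication by ∏_{m<M} (1 - q^{4m+2}).
E : ℕ → Series → Series
E zero    f n = f n
E (suc M) f n = E M f n - E M f (n - + suc (suc (M * 2 * 2)))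

E-cong : ∀ M {f g : Series} → (∀ n → f n ≡ g n) → ∀ n → E M f n ≡ E M g n
E-cong zero    f≗g n = f≗g n
E-cong (suc M) f≗g n = cong₂ _-_ (E-cong M f≗g n) (E-cong M f≗g _)

-- `E` is multiplication by a polynomial, hence linear and compatible with powers of q; this carries
-- the recurrences of `O` over to `W`.
E-minus-shift : ∀ M (f g : Series) a n →
  E M (λ m → f m - g (m - + a)) n ≡ E M f n - E M g (n - + a)
E-minus-shift zero    f g a n = refl
E-minus-shift (suc M) f g a n
  rewrite E-minus-shift M f g a n | E-minus-shift M f g a (n - + suc (suc (M * 2 * 2)))
  | shifts-agree n (suc (suc (M * 2 * 2))) a a (suc (suc (M * 2 * 2))) (ℕ.+-comm (suc (suc (M * 2 * 2))) a)
  = minus-interchange (E M f n) _ _ _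

E-negative : ∀ M (f : Series) → (∀ k → f -[1+ k ] ≡ 0ℤ) → ∀ k → E M f -[1+ k ] ≡ 0ℤ
E-negative zero    f f≡0 k = f≡0 k
E-negative (suc M) f f≡0 k rewrite E-negative M f f≡0 k
  | E-negative M f f≡0 (suc (k + suc (M * 2 * 2))) = refl

O-negative : ∀ K j k → O K j -[1+ k ] ≡ 0ℤ
O-negative K       zero    k = refl
O-negative zero    (suc j) k = refl
O-negative (suc K) (suc j) k
  rewrite O-negative K (suc j) k | O-negative K j (suc (k + K * 2)) = refl

-- The solution f(M, j), with `K` freed from `M` and `j`: 𝒫₄ will lead to `K = 2M + j`, 𝒮₄ to
-- `K = 2M`.
W : ℕ → ℕ → ℕ → Series
W M K j = E M (O K j)

W-pascal : ∀ M K j n → W M (suc K) (suc j) n ≡ W M K (suc j) n - W M K j (n - + suc (K * 2))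
W-pascal M K j n = E-minus-shift M (O K (suc j)) (O K j) (suc (K * 2)) n

-- The new factor of `E (suc M)` is 1 - q^{4M+2}, so `O-absorption` is applied with `d = 2M + 1`;
-- its condition `d + j = K + 1` is what forces `K = 2M + j`.
W-absorption : ∀ M K j n → K ≡ M * 2 + j →
  W (suc M) (suc K) j n ≡ W M K j n - W M K j (n - + (suc K * 2))
W-absorption M K j n eq = begin
  W M (suc K) j n - W M (suc K) j (n - + suc (suc (M * 2 * 2)))
    ≡⟨ E-minus-shift M (O (suc K) j) (O (suc K) j) _ n ⟨
  E M (λ m → O (suc K) j m - O (suc K) j (m - + (suc (M * 2) * 2))) n
    ≡⟨ E-cong M (λ m → O-absorption K j (suc (M * 2)) m (cong suc (sym eq))) n ⟩
  E M (λ m → O K j m - O K j (m - + (suc K * 2))) n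
    ≡⟨ E-minus-shift M (O K j) (O K j) _ n ⟩
  W M K j n - W M K j (n - + (suc K * 2)) ∎
  where
  open ≡-Reasoning

minus-larger : ∀ {n N} → n ≤ N → + n - + suc N ≡ -[1+ (N ∸ n) ]
minus-larger {n} {N} n≤N = trans (ℤ.m-n≡m⊖n n (suc N)) (trans (ℤ.⊖-< (s≤s n≤N)) (cong (λ m → - + m) (ℕ.+-∸-assoc 1 n≤N)))

-- Raising `K` further only adds candidate odd parts above `n`; their term in Pascal's rule is read
-- at a negative exponent, where it is 0.
W-stable : ∀ M K d j n → n ≤ K * 2 → W M (d + K) j (+ n) ≡ W M K j (+ n)
W-stable M K zero    j       n n≤2K = refl
W-stable M K (suc d) zero    n n≤2K = refl
W-stable M K (suc d) (suc j) n n≤2K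
  rewrite W-pascal M (d + K) j (+ n)
  | minus-larger (ℕ.≤-trans n≤2K (ℕ.*-monoˡ-≤ 2 (ℕ.m≤n+m K d)))
  | E-negative M (O (d + K) j) (O-negative (d + K) j) ((d + K) * 2 ∸ n)
  = trans (ℤ.+-identityʳ _) (W-stable M K d (suc j) n n≤2K)

-- Weighted generating functions of lists of partitions.

sgn : List ℕ → ℤ
sgn []      = 1ℤ
sgn (_ ∷ l) = - sgn l

odds : List ℕ → ℕ
odds []      = 0
odds (a ∷ l) = if isEven a then odds l else suc (odds l)

-- The coefficient of q^n in the sum of w(l) q^{sum l} over the lists l.
coef : (List ℕ → ℤ) → List (List ℕ) → Series
coef w []      n = 0ℤ
coef w (l ∷ L) n = (if does (+ sum l ≟ℤ n) then w l else 0ℤ) +ℤ coef w L n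

coef-cong : ∀ {w v : List ℕ → ℤ} {L} → All (λ l → w l ≡ v l) L → ∀ n → coef w L n ≡ coef v L n
coef-cong                 []          n = refl
coef-cong {L = l ∷ _} (wl≡vl ∷ w≗v) n =
  cong₂ (λ x y → (if does (+ sum l ≟ℤ n) then x else 0ℤ) +ℤ y) wl≡vl (coef-cong w≗v n)

coef-zero : ∀ {w : List ℕ → ℤ} {L} → All (λ l → w l ≡ 0ℤ) L → ∀ n → coef w L n ≡ 0ℤ
coef-zero                 []          n = refl
coef-zero {L = l ∷ _} (wl≡0 ∷ w≗0) n rewrite wl≡0 | coef-zero w≗0 n with does (+ sum l ≟ℤ n)
... | true  = refl
... | false = refl

coef-neg : ∀ (w : List ℕ → ℤ) L n → coef (λ l → - w l) L n ≡ - coef w L n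
coef-neg w []      n = refl
coef-neg w (l ∷ L) n rewrite coef-neg w L n with does (+ sum l ≟ℤ n)
... | true  = sym (ℤ.neg-distrib-+ (w l) (coef w L n))
... | false = sym (ℤ.neg-distrib-+ 0ℤ (coef w L n))

private
  +-interchange : ∀ x y z t → (x +ℤ y) +ℤ (z +ℤ t) ≡ (x +ℤ z) +ℤ (y +ℤ t)
  +-interchange = ℤ-solver.solve-∀

coef-+ : ∀ (w v : List ℕ → ℤ) L n → coef (λ l → w l +ℤ v l) L n ≡ coef w L n +ℤ coef v L n
coef-+ w v []      n = refl
coef-+ w v (l ∷ L) n rewrite coef-+ w v L n with does (+ sum l ≟ℤ n)
... | true  = +-interchange (w l) (v l) (coef w L n) (coef v L n)
... | false = +-interchange 0ℤ 0ℤ (coef w L n) (coef v L n)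

coef-++ : ∀ w L L′ n → coef w (L ++ L′) n ≡ coef w L n +ℤ coef w L′ n
coef-++ w []      L′ n = sym (ℤ.+-identityˡ _)
coef-++ w (l ∷ L) L′ n =
  trans (cong (λ x → (if does (+ sum l ≟ℤ n) then w l else 0ℤ) +ℤ x) (coef-++ w L L′ n))
        (sym (ℤ.+-assoc (if does (+ sum l ≟ℤ n) then w l else 0ℤ) _ _))

coef-map-∷ : ∀ w a L n → coef w (map (a ∷_) L) n ≡ coef (w ∘ (a ∷_)) L (n - + a)
coef-map-∷ w a []      n = refl
-- Over ℤ the conditions `a + sum l = n` and `sum l = n - a` are equivalent even for `a > n`, so
-- both tests give the same Boolean.
coef-map-∷ w a (l ∷ L) n = cong₂ (λ b x → (if b then w (a ∷ l) else 0ℤ) +ℤ x)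
  (does-⇔ (mk⇔ to from) (+ (a + sum l) ≟ℤ n) (+ sum l ≟ℤ n - + a)) (coef-map-∷ w a L n)
  where
  cancel : ∀ x y → y ≡ (x +ℤ y) - x
  cancel = ℤ-solver.solve-∀
  restore : ∀ x m → x +ℤ (m - x) ≡ m
  restore = ℤ-solver.solve-∀
  to : + (a + sum l) ≡ n → + sum l ≡ n - + a
  to refl = trans (cancel (+ a) (+ sum l)) (cong (λ m → m - + a) (sym (ℤ.pos-+ a (sum l))))
  from : + sum l ≡ n - + a → + (a + sum l) ≡ n
  from eq = trans (ℤ.pos-+ a (sum l)) (trans (cong (+ a +ℤ_) eq) (restore (+ a) n))

coef-sublists-∷ : ∀ w a xs n →
  coef w (sublists (a ∷ xs)) n ≡ coef (w ∘ (a ∷_)) (sublists xs) (n - + a) +ℤ coef w (sublists xs) n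
coef-sublists-∷ w a xs n =
  trans (coef-++ w (map (a ∷_) (sublists xs)) (sublists xs) n)
        (cong (λ x → x +ℤ coef w (sublists xs) n) (coef-map-∷ w a (sublists xs) n))

coef-negative : ∀ w L k → coef w L -[1+ k ] ≡ 0ℤ
coef-negative w []      k = refl
coef-negative w (l ∷ L) k = trans (ℤ.+-identityˡ _) (coef-negative w L k)

-- The head `suc N` is part of the statement because the recurrences below put exactly this part on
-- top of `l`.
sublists-decreasing : ∀ N → All (λ l → Linked _>_ (suc N ∷ l)) (sublists (downFrom1 N))
sublists-decreasing zero    = [-] ∷ []
sublists-decreasing (suc N) =
  ++⁺ (map⁺ (All.map (ℕ.n<1+n (suc N) ∷_) (sublists-decreasing N))) (All.map raise (sublists-decreasing N))
  where
  raise : ∀ {l} → Linked _>_ (suc N ∷ l) → Linked _>_ (suc (suc N) ∷ l)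
  raise [-]         = [-]
  raise (b<N ∷ dec) = ℕ.m<n⇒m<1+n b<N ∷ dec

sublists-odds : ∀ N → All (λ l → odds l ≤ ⌈ N /2⌉) (sublists (downFrom1 N))
sublists-odds zero    = z≤n ∷ []
sublists-odds (suc N) =
  ++⁺ (map⁺ (All.map (λ {l} → cons {l}) (sublists-odds N))) (All.map (λ le → ℕ.≤-trans le (ℕ.⌈n/2⌉-mono (ℕ.n≤1+n N))) (sublists-odds N))
  where
  suc⌈N/2⌉ : ∀ N → isEven (suc N) ≡ false → suc ⌈ N /2⌉ ≤ ⌈ suc N /2⌉
  suc⌈N/2⌉ zero          _   = ℕ.≤-refl
  suc⌈N/2⌉ (suc (suc N)) odd = s≤s (suc⌈N/2⌉ N odd)
  cons : ∀ {l} → odds l ≤ ⌈ N /2⌉ → odds (suc N ∷ l) ≤ ⌈ suc N /2⌉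
  cons le with isEven (suc N) in parity
  ... | true  = ℕ.≤-trans le (ℕ.⌈n/2⌉-mono (ℕ.n≤1+n N))
  ... | false = ℕ.≤-trans (s≤s le) (suc⌈N/2⌉ N parity)

-- Recurrences in the largest part, graded by the number of odd parts.

weight : (List ℕ → Bool) → ℕ → List ℕ → ℤ
weight P j l = if P l ∧ (odds l ≡ᵇ j) then sgn l else 0ℤ

-- ok a k decides whether a part a may be put on top of a list with k odd parts.
module Graded (P : List ℕ → Bool) (ok : ℕ → ℕ → Bool)
              (P-[] : P [] ≡ true)
              (P-∷ : ∀ {a l} → Linked _>_ (a ∷ l) → P (a ∷ l) ≡ P l ∧ ok a (odds l)) where

  F : ℕ → ℕ → Series
  F j N = coef (weight P j) (sublists (downFrom1 N))

  F-zero-0 : ∀ n → F 0 0 n ≡ δ n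
  F-zero-0 n rewrite P-[] = ℤ.+-identityʳ _

  F-suc-0 : ∀ j n → F (suc j) 0 n ≡ 0ℤ
  F-suc-0 j n rewrite P-[] with does (+ 0 ≟ℤ n)
  ... | true  = refl
  ... | false = refl

  F-vanish : ∀ j N n → ⌈ N /2⌉ < j → F j N n ≡ 0ℤ
  F-vanish j N n N<j = coef-zero (All.map (λ {l} → zero-weight {l}) (sublists-odds N)) n
    where
    zero-weight : ∀ {l} → odds l ≤ ⌈ N /2⌉ → weight P j l ≡ 0ℤ
    zero-weight {l} le with odds l ≡ᵇ j in eq
    ... | false rewrite ∧-zeroʳ (P l) = refl
    ... | true  = contradiction (ℕ.≡ᵇ⇒≡ _ _ (subst T (sym eq) _)) (ℕ.<⇒≢ (ℕ.≤-<-trans le N<j))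

  -- A part larger than `n` would leave a negative exponent for the remaining parts.
  F-stable : ∀ j {n N} → n ≤ N → F j N (+ n) ≡ F j n (+ n)
  F-stable j {n} {N} n≤N = subst (λ m → F j m (+ n) ≡ F j n (+ n)) (ℕ.m∸n+n≡m n≤N) (above (N ∸ n))
    where
    above : ∀ d → F j (d + n) (+ n) ≡ F j n (+ n)
    above zero    = refl
    above (suc d)
      rewrite coef-sublists-∷ (weight P j) (suc (d + n)) (downFrom1 (d + n)) (+ n)
      | minus-larger (ℕ.m≤n+m n d)
      | coef-negative (weight P j ∘ (suc (d + n) ∷_)) (sublists (downFrom1 (d + n))) ((d + n) ∸ n)
      = trans (ℤ.+-identityˡ _) (above d)

  private
    F-skip : ∀ j N n → All (λ l → weight P j (suc N ∷ l) ≡ 0ℤ) (sublists (downFrom1 N)) →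
             F j (suc N) n ≡ F j N n
    F-skip j N n w≗0 =
      trans (coef-sublists-∷ (weight P j) (suc N) (downFrom1 N) n)
      (trans (cong (λ x → x +ℤ F j N n) (coef-zero w≗0 _)) (ℤ.+-identityˡ _))

    -- Split by whether `suc N` is a part. Removing it flips the sign (-1)^ℓ, lowers the exponent by
    -- `suc N`, and leaves `i` odd parts.
    F-take : ∀ i j N n → All (λ l → weight P j (suc N ∷ l) ≡ - weight P i l) (sublists (downFrom1 N)) →
             F j (suc N) n ≡ F j N n - F i N (n - + suc N)
    F-take i j N n w≗-v =
      trans (coef-sublists-∷ (weight P j) (suc N) (downFrom1 N) n)
      (trans (cong (λ x → x +ℤ F j N n)
                   (trans (coef-cong w≗-v _) (coef-neg (weight P i) (sublists (downFrom1 N)) _)))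
             (ℤ.+-comm (- F i N (n - + suc N)) (F j N n)))

    -- The last hypothesis covers even `a` (`i = j`) and odd `a` (`j = suc i`) at once. Lists with
    -- `odds l` other than `i` have weight 0 on both sides, so `ok` need only be known at `i`.
    weight-hit : ∀ {a i j} l → ok a i ≡ true → Linked _>_ (a ∷ l) →
                 (odds (a ∷ l) ≡ᵇ j) ≡ (odds l ≡ᵇ i) → weight P j (a ∷ l) ≡ - weight P i l
    weight-hit {a} {i} l hit dec match
      rewrite match | P-∷ dec with odds l ≡ᵇ i in eq
    ... | false rewrite ∧-zeroʳ (P l) | ∧-zeroʳ (P l ∧ ok a (odds l)) = refl
    ... | true rewrite ℕ.≡ᵇ⇒≡ (odds l) i (subst T (sym eq) _) | hit with P l
    ...   | true  = refl
    ...   | false = refl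

    weight-miss : ∀ {a i j} l → ok a i ≡ false → Linked _>_ (a ∷ l) →
                  (odds (a ∷ l) ≡ᵇ j) ≡ (odds l ≡ᵇ i) → weight P j (a ∷ l) ≡ 0ℤ
    weight-miss {a} {i} l miss dec match
      rewrite match | P-∷ dec with odds l ≡ᵇ i in eq
    ... | false rewrite ∧-zeroʳ (P l ∧ ok a (odds l)) = refl
    ... | true rewrite ℕ.≡ᵇ⇒≡ (odds l) i (subst T (sym eq) _) | miss | ∧-zeroʳ (P l) = refl

    even-match : ∀ {a} j l → isEven a ≡ true → (odds (a ∷ l) ≡ᵇ j) ≡ (odds l ≡ᵇ j)
    even-match j l even rewrite even = refl

    odd-match : ∀ {a} j l → isEven a ≡ false → (odds (a ∷ l) ≡ᵇ suc j) ≡ (odds l ≡ᵇ j)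
    odd-match j l odd rewrite odd = refl

  F-even-hit : ∀ j N n → isEven (suc N) ≡ true → ok (suc N) j ≡ true →
               F j (suc N) n ≡ F j N n - F j N (n - + suc N)
  F-even-hit j N n even hit = F-take j j N n
    (All.map (λ {l} dec → weight-hit l hit dec (even-match {suc N} j l even)) (sublists-decreasing N))

  F-even-miss : ∀ j N n → isEven (suc N) ≡ true → ok (suc N) j ≡ false → F j (suc N) n ≡ F j N n
  F-even-miss j N n even miss = F-skip j N n
    (All.map (λ {l} dec → weight-miss l miss dec (even-match {suc N} j l even)) (sublists-decreasing N))

  F-odd-hit : ∀ j N n → isEven (suc N) ≡ false → ok (suc N) j ≡ true →
              F (suc j) (suc N) n ≡ F (suc j) N n - F j N (n - + suc N)
  F-odd-hit j N n odd hit = F-take j (suc j) N n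
    (All.map (λ {l} dec → weight-hit l hit dec (odd-match {suc N} j l odd)) (sublists-decreasing N))

  F-odd-miss : ∀ j N n → isEven (suc N) ≡ false → ok (suc N) j ≡ false → F (suc j) (suc N) n ≡ F (suc j) N n
  F-odd-miss j N n odd miss = F-skip (suc j) N n
    (All.map (λ {l} dec → weight-miss l miss dec (odd-match {suc N} j l odd)) (sublists-decreasing N))

  F-odd-zero : ∀ N n → isEven (suc N) ≡ false → F 0 (suc N) n ≡ F 0 N n
  F-odd-zero N n odd = F-skip 0 N n (All.map (λ {l} _ → zero-weight l) (sublists-decreasing N))
    where
    zero-weight : ∀ l → weight P 0 (suc N ∷ l) ≡ 0ℤ
    zero-weight l rewrite odd | ∧-zeroʳ (P (suc N ∷ l)) = refl

-- Congruence description of 𝒮₄ and 𝒫₄.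

isEven-double : ∀ k m → isEven (k * 2 + m) ≡ isEven m
isEven-double zero    m = refl
isEven-double (suc k) m = isEven-double k m

okS : ℕ → ℕ → Bool
okS a _ = not ((a % 4) ≡ᵇ 0)

module S = Graded inS4 okS refl (λ {a} {l} _ → ∧-comm (okS a 0) (inS4 l))

-- Says a ≡ 1 + 2k (mod 4) if a is odd, a ≡ 2 + 2k (mod 4) if a is even; here 2k ≡ -2k (mod 4).
okP : ℕ → ℕ → Bool
okP a k = (((k * 2 + a) % 4) ≡ᵇ 1) ∨ (((k * 2 + a) % 4) ≡ᵇ 2)

-- Taking the parities as arguments detaches the condition from the parts, which can then be shifted
-- by an even number.
gap : Bool → Bool → ℕ → Bool
gap false false d = (d % 4) ≡ᵇ 2
gap true  true  d = (d % 4) ≡ᵇ 0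
gap _     _     d = (d % 4) ≡ᵇ 3

gap-4+ : ∀ p r d → gap p r (4 + d) ≡ gap p r d
gap-4+ false false d = refl
gap-4+ false true  d = refl
gap-4+ true  false d = refl
gap-4+ true  true  d = refl

gapOK-+ : ∀ d b → gapOK (d + b) b ≡ gap (isEven (d + b)) (isEven b) d
gapOK-+ d b with isEven (d + b) | isEven b
... | false | false rewrite ℕ.m+n∸n≡m d b = refl
... | false | true  rewrite ℕ.m+n∸n≡m d b = refl
... | true  | false rewrite ℕ.m+n∸n≡m d b = refl
... | true  | true  rewrite ℕ.m+n∸n≡m d b = refl

-- u stands for b + 2k, and d for the gap between b and the next part.
gap-residue : ∀ d u → okP u 0 ≡ true →
              gap (isEven (d + u)) (isEven u) d ≡ (if isEven u then okP (d + u) 0 else okP (d + (2 + u)) 0)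
gap-residue 0 1 _ = refl
gap-residue 0 2 _ = refl
gap-residue 0 (suc (suc (suc (suc u)))) ok = gap-residue 0 u ok
gap-residue 1 1 _ = refl
gap-residue 1 2 _ = refl
gap-residue 1 (suc (suc (suc (suc u)))) ok = gap-residue 1 u ok
gap-residue 2 1 _ = refl
gap-residue 2 2 _ = refl
gap-residue 2 (suc (suc (suc (suc u)))) ok = gap-residue 2 u ok
gap-residue 3 1 _ = refl
gap-residue 3 2 _ = refl
gap-residue 3 (suc (suc (suc (suc u)))) ok = gap-residue 3 u ok
gap-residue (suc (suc (suc (suc d)))) u ok =
  trans (gap-4+ (isEven (d + u)) (isEven u) d) (gap-residue d u ok)

-- Passing from `b` to `u = b + 2k` changes neither the parities nor the gap, and reduces the claim
-- to a check mod 4. An odd `b` is itself one more odd part, whence the `2 + u`.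
gapOK-okP : ∀ d b k → okP b k ≡ true → gapOK (d + b) b ≡ okP (d + b) (if isEven b then k else suc k)
gapOK-okP d b k ok = begin
  gapOK (d + b) b
    ≡⟨ gapOK-+ d b ⟩
  gap (isEven (d + b)) (isEven b) d
    ≡⟨ cong₂ (λ p r → gap p r d) (trans (sym (isEven-double k (d + b))) (cong isEven (sym (swap d 0)))) (sym (isEven-double k b)) ⟩
  gap (isEven (d + u)) (isEven u) d
    ≡⟨ gap-residue d u ok ⟩
  (if isEven u then okP (d + u) 0 else okP (d + (2 + u)) 0)
    ≡⟨ cong₂ (λ x y → if isEven u then okP x 0 else okP y 0) (swap d 0) (swap d 2) ⟩
  (if isEven u then okP (d + b) k else okP (d + b) (suc k))
    ≡⟨ cong (λ e → if e then okP (d + b) k else okP (d + b) (suc k)) (isEven-double k b) ⟩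
  (if isEven b then okP (d + b) k else okP (d + b) (suc k))
    ≡⟨ if-float (okP (d + b)) (isEven b) ⟨
  okP (d + b) (if isEven b then k else suc k) ∎
  where
  open ≡-Reasoning
  u = k * 2 + b
  swap : ∀ d c → d + (c + (k * 2 + b)) ≡ c + (k * 2 + (d + b))
  swap d c = rearrange d c (k * 2) b
    where
    rearrange : ∀ d c x b → d + (c + (x + b)) ≡ c + (x + (d + b))
    rearrange = ℕ-solver.solve-∀

-- By induction the part `b` below has the right residue, and then the gap condition on `a` is
-- equivalent to the residue condition on `a`. If the tail is not in 𝒫₄, both sides are false.
inP4-∷ : ∀ {a l} → Linked _>_ (a ∷ l) → inP4 (a ∷ l) ≡ inP4 l ∧ okP a (odds l)
inP4-∷ [-] = refl
inP4-∷ {a} {b ∷ l} (a>b ∷ dec)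
  rewrite inP4-∷ dec with inP4 l | okP b (odds l) in ok
... | false | _     = ∧-zeroʳ (gapOK a b)
... | true  | false = ∧-zeroʳ (gapOK a b)
... | true  | true  = trans (∧-identityʳ (gapOK a b))
  (subst (λ m → gapOK m b ≡ okP m (odds (b ∷ l))) (ℕ.m∸n+n≡m (ℕ.<⇒≤ a>b)) (gapOK-okP (a ∸ b) b (odds l) ok))

module P = Graded inP4 okP refl inP4-∷

-- Identification of both graded generating functions with `W`.

isEven-even : ∀ k → isEven (k * 2) ≡ true
isEven-even zero    = refl
isEven-even (suc k) = isEven-even k

isEven-odd : ∀ k → isEven (suc (k * 2)) ≡ false
isEven-odd zero    = refl
isEven-odd (suc k) = isEven-odd k

okS-residue : ∀ r m j → okS (r + m * 2 * 2) j ≡ okS r j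
okS-residue r m j rewrite ℕ.*-assoc m 2 2 = cong (λ x → not (x ≡ᵇ 0)) ([m+kn]%n≡m%n r m 4)

-- Four candidate parts per step: 4m + 1 and 4m + 3 each raise `K` by Pascal's rule, 4m + 2 supplies
-- the next factor of `E`, and 4m + 4 is forbidden.
S-F≡W : ∀ m j n → S.F j (m * 2 * 2) n ≡ W m (m * 2) j n
S-F≡W zero    zero    n = S.F-zero-0 n
S-F≡W zero    (suc j) n = S.F-suc-0 j n
S-F≡W (suc m) j       n = trans (S.F-even-miss j (3 + N) n (isEven-even K) (okS-residue 4 m j)) (step₃ j n)
  where
  K = m * 2
  N = K * 2

  step₁ : ∀ j n → S.F j (1 + N) n ≡ W m (1 + K) j n
  step₁ zero    n = trans (S.F-odd-zero N n (isEven-odd K)) (S-F≡W m zero n)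
  step₁ (suc j) n = begin
    S.F (suc j) (1 + N) n
      ≡⟨ S.F-odd-hit j N n (isEven-odd K) (okS-residue 1 m j) ⟩
    S.F (suc j) N n - S.F j N (n - + (1 + N))
      ≡⟨ cong₂ _-_ (S-F≡W m (suc j) n) (S-F≡W m j _) ⟩
    W m K (suc j) n - W m K j (n - + (1 + N))
      ≡⟨ W-pascal m K j n ⟨
    W m (1 + K) (suc j) n ∎
    where open ≡-Reasoning

  step₂ : ∀ j n → S.F j (2 + N) n ≡ W (suc m) (1 + K) j n
  step₂ j n = trans (S.F-even-hit j (1 + N) n (isEven-even K) (okS-residue 2 m j))
                    (cong₂ _-_ (step₁ j n) (step₁ j _))

  step₃ : ∀ j n → S.F j (3 + N) n ≡ W (suc m) (2 + K) j n
  step₃ zero    n = trans (S.F-odd-zero (2 + N) n (isEven-odd K)) (step₂ zero n)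
  step₃ (suc j) n = begin
    S.F (suc j) (3 + N) n
      ≡⟨ S.F-odd-hit j (2 + N) n (isEven-odd K) (okS-residue 3 m j) ⟩
    S.F (suc j) (2 + N) n - S.F j (2 + N) (n - + (3 + N))
      ≡⟨ cong₂ _-_ (step₂ (suc j) n) (step₂ j _) ⟩
    W (suc m) (1 + K) (suc j) n - W (suc m) (1 + K) j (n - + (3 + N))
      ≡⟨ W-pascal (suc m) (1 + K) j n ⟨
    W (suc m) (2 + K) (suc j) n ∎
    where open ≡-Reasoning

-- Since 2j + 2(2M + j) = 4(M + j), measuring parts from the bound 2K absorbs the dependence of the
-- residue on `j`. This is why the bound varies with `j`.
okP-residue : ∀ r M j → okP (r + (M * 2 + j) * 2) j ≡ okP r 0
okP-residue r M j = cong (λ x → (x ≡ᵇ 1) ∨ (x ≡ᵇ 2))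
  (trans (cong (_% 4) (collect r M j)) ([m+kn]%n≡m%n r (M + j) 4))
  where
  collect : ∀ r M j → j * 2 + (r + (M * 2 + j) * 2) ≡ r + (M + j) * 4
  collect = ℕ-solver.solve-∀

⌈2k/2⌉ : ∀ k → ⌈ k * 2 /2⌉ ≡ k
⌈2k/2⌉ zero    = refl
⌈2k/2⌉ (suc k) = cong suc (⌈2k/2⌉ k)

-- For M, j > 0 and K = 2M + j, the parts 2K and 2K - 3 have the wrong residue, 2K - 1 leads to (M,
-- j - 1), and 2K - 2 gives the factor 1 - q^{2K-2} over the bound 2(K - 2) of (M - 1, j).
P-F≡W : ∀ M j n → P.F j ((M * 2 + j) * 2) n ≡ W M (M * 2 + j) j n
P-F≡W zero zero n = P.F-zero-0 n
P-F≡W zero (suc j) n = begin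
  P.F (suc j) (2 + N) n
    ≡⟨ P.F-even-miss (suc j) (1 + N) n (isEven-even j) (okP-residue 0 0 (suc j)) ⟩
  P.F (suc j) (1 + N) n
    ≡⟨ P.F-odd-hit j N n (isEven-odd j) (okP-residue 1 0 j) ⟩
  P.F (suc j) N n - P.F j N (n - + (1 + N))
    -- There are only `j` odd numbers up to `2j`, so `suc j` odd parts force the part `2j + 1`.
    ≡⟨ cong₂ _-_ (P.F-vanish (suc j) N n (s≤s (ℕ.≤-reflexive (⌈2k/2⌉ j)))) (P-F≡W zero j _) ⟩
  0ℤ - O j j (n - + (1 + N))
    ≡⟨ cong (λ x → x - O j j (n - + (1 + N))) (O-vanish j (suc j) n (ℕ.n<1+n j)) ⟨
  W zero (suc j) (suc j) n ∎
  where
  open ≡-Reasoning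
  N = j * 2
P-F≡W (suc M) zero n = begin
  P.F 0 (4 + N) n
    ≡⟨ P.F-even-miss 0 (3 + N) n (isEven-even K) (okP-residue 4 M 0) ⟩
  P.F 0 (3 + N) n
    ≡⟨ P.F-odd-zero (2 + N) n (isEven-odd K) ⟩
  P.F 0 (2 + N) n
    ≡⟨ P.F-even-hit 0 (1 + N) n (isEven-even K) (okP-residue 2 M 0) ⟩
  P.F 0 (1 + N) n - P.F 0 (1 + N) (n - + (2 + N))
    ≡⟨ cong₂ _-_ (P.F-odd-zero N n (isEven-odd K)) (P.F-odd-zero N _ (isEven-odd K)) ⟩
  P.F 0 N n - P.F 0 N (n - + (2 + N))
    ≡⟨ cong₂ _-_ (P-F≡W M 0 n) (P-F≡W M 0 _) ⟩
  W M K 0 n - W M K 0 (n - + (2 + N))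
    ≡⟨ W-absorption M K 0 n refl ⟨
  W (suc M) (2 + K) 0 n ∎
  where
  open ≡-Reasoning
  K = M * 2 + 0
  N = K * 2
P-F≡W (suc M) (suc j) n = subst (λ K → P.F (suc j) ((2 + K) * 2) n ≡ W (suc M) (2 + K) (suc j) n) (sym 1+K) (begin
  P.F (suc j) (6 + N) n
    ≡⟨ P.F-even-miss (suc j) (5 + N) n (isEven-even K) (okP-suc 4) ⟩
  P.F (suc j) (5 + N) n
    ≡⟨ P.F-odd-hit j (4 + N) n (isEven-odd K) (okP-residue 5 M j) ⟩
  P.F (suc j) (4 + N) n - P.F j (4 + N) (n - + (5 + N))
    ≡⟨ cong₂ _-_ descend (P-F≡W (suc M) j _) ⟩
  W (suc M) (2 + K) (suc j) n - W (suc M) (2 + K) j (n - + (5 + N))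
    ≡⟨ W-pascal (suc M) (2 + K) j n ⟨
  W (suc M) (3 + K) (suc j) n ∎)
  where
  open ≡-Reasoning
  K = M * 2 + j
  N = K * 2

  1+K : M * 2 + suc j ≡ 1 + K
  1+K = ℕ.+-suc (M * 2) j

  okP-suc : ∀ r → okP (r + (2 + N)) (suc j) ≡ okP r 0
  okP-suc r = trans (cong (λ K → okP (r + K * 2) (suc j)) (sym 1+K)) (okP-residue r M (suc j))

  below : ∀ n → P.F (suc j) (3 + N) n ≡ W M (1 + K) (suc j) n
  below n = trans (P.F-odd-miss j (2 + N) n (isEven-odd K) (okP-residue 3 M j))
                  (subst (λ K → P.F (suc j) (K * 2) n ≡ W M K (suc j) n) 1+K (P-F≡W M (suc j) n))

  descend : P.F (suc j) (4 + N) n ≡ W (suc M) (2 + K) (suc j) n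
  descend = begin
    P.F (suc j) (4 + N) n
      ≡⟨ P.F-even-hit (suc j) (3 + N) n (isEven-even K) (okP-suc 2) ⟩
    P.F (suc j) (3 + N) n - P.F (suc j) (3 + N) (n - + (4 + N))
      ≡⟨ cong₂ _-_ (below n) (below _) ⟩
    W M (1 + K) (suc j) n - W M (1 + K) (suc j) (n - + (4 + N))
      ≡⟨ W-absorption M (1 + K) (suc j) n (sym 1+K) ⟨
    W (suc M) (2 + K) (suc j) n ∎

-- With `M = n` the bounds 2(2n + j) and 4n are both at least `n`, so they exclude no partition of
-- `n`; `W-stable` bridges `K = 2n + j` and `K = 2n`.
P-F≡S-F : ∀ n j → P.F j n (+ n) ≡ S.F j n (+ n)
P-F≡S-F n j = begin
  P.F j n (+ n)                 ≡⟨ P.F-stable j (ℕ.≤-trans n≤4n (ℕ.*-monoˡ-≤ 2 (ℕ.m≤m+n (n * 2) j))) ⟨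
  P.F j ((n * 2 + j) * 2) (+ n) ≡⟨ P-F≡W n j (+ n) ⟩
  W n (n * 2 + j) j (+ n)       ≡⟨ cong (λ K → W n K j (+ n)) (ℕ.+-comm (n * 2) j) ⟩
  W n (j + n * 2) j (+ n)       ≡⟨ W-stable n (n * 2) j j n n≤4n ⟩
  W n (n * 2) j (+ n)           ≡⟨ S-F≡W n j (+ n) ⟨
  S.F j (n * 2 * 2) (+ n)       ≡⟨ S.F-stable j n≤4n ⟩
  S.F j n (+ n)                 ∎
  where
  open ≡-Reasoning
  n≤4n : n ≤ n * 2 * 2
  n≤4n = ℕ.≤-trans (ℕ.m≤m*n n 2) (ℕ.m≤m*n (n * 2) 2)

-- Summation over the number of odd parts and return to the counts.

signed : (List ℕ → Bool) → List ℕ → ℤ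
signed P l = if P l then sgn l else 0ℤ

sumBelow : ℕ → (ℕ → ℤ) → ℤ
sumBelow zero    f = 0ℤ
sumBelow (suc J) f = sumBelow J f +ℤ f J

sumBelow-cong : ∀ J {f g : ℕ → ℤ} → (∀ j → f j ≡ g j) → sumBelow J f ≡ sumBelow J g
sumBelow-cong zero    f≗g = refl
sumBelow-cong (suc J) f≗g = cong₂ _+ℤ_ (sumBelow-cong J f≗g) (f≗g J)

sumBelow-weight-zero : ∀ P l J → J ≤ odds l → sumBelow J (λ j → weight P j l) ≡ 0ℤ
sumBelow-weight-zero P l zero    J≤odds = refl
sumBelow-weight-zero P l (suc J) J<odds
  rewrite sumBelow-weight-zero P l J (ℕ.<⇒≤ J<odds) with odds l ≡ᵇ J in eq
... | false rewrite ∧-zeroʳ (P l) = refl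
... | true  = contradiction (sym (ℕ.≡ᵇ⇒≡ _ _ (subst T (sym eq) _))) (ℕ.<⇒≢ J<odds)

-- Only the summand `j = odds l` survives.
sumBelow-weight : ∀ P l J → odds l < J → sumBelow J (λ j → weight P j l) ≡ signed P l
sumBelow-weight P l (suc J) (s≤s odds≤J) with odds l ≡ᵇ J in eq
... | true  rewrite ∧-identityʳ (P l)
                  | sumBelow-weight-zero P l J (ℕ.≤-reflexive (sym (ℕ.≡ᵇ⇒≡ (odds l) J (subst T (sym eq) _))))
  = ℤ.+-identityˡ _
... | false rewrite ∧-zeroʳ (P l) =
  trans (ℤ.+-identityʳ _) (sumBelow-weight P l J (ℕ.≤∧≢⇒< odds≤J λ odds≡J → subst T eq (ℕ.≡⇒≡ᵇ _ _ odds≡J)))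

coef-sumBelow : ∀ J (u : ℕ → List ℕ → ℤ) L n →
  coef (λ l → sumBelow J (λ j → u j l)) L n ≡ sumBelow J (λ j → coef (u j) L n)
coef-sumBelow zero    u L n = coef-zero (All.universal (λ _ → refl) L) n
coef-sumBelow (suc J) u L n =
  trans (coef-+ (λ l → sumBelow J (λ j → u j l)) (u J) L n)
        (cong (λ x → x +ℤ coef (u J) L n) (coef-sumBelow J u L n))

coef-by-odds : ∀ P n →
  coef (signed P) (sublists (downFrom1 n)) (+ n)
    ≡ sumBelow (suc n) (λ j → coef (weight P j) (sublists (downFrom1 n)) (+ n))
coef-by-odds P n = trans
  (coef-cong (All.map (λ {l} le → sym (sumBelow-weight P l (suc n) (s≤s (ℕ.≤-trans le (ℕ.⌈n/2⌉≤n n))))) (sublists-odds n)) (+ n))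
  (coef-sumBelow (suc n) (weight P) (sublists (downFrom1 n)) (+ n))

isEven-suc : ∀ k → isEven (suc k) ≡ not (isEven k)
isEven-suc zero          = refl
isEven-suc (suc zero)    = refl
isEven-suc (suc (suc k)) = isEven-suc k

sgn-length : ∀ l → sgn l ≡ (if isEven (length l) then 1ℤ else -1ℤ)
sgn-length []      = refl
sgn-length (a ∷ l) rewrite isEven-suc (length l) | sgn-length l with isEven (length l)
... | true  = refl
... | false = refl

signed-count : ∀ P n → + countEven P n - + countOdd P n ≡ coef (signed P) (sublists (downFrom1 n)) (+ n)
signed-count P n = go (sublists (downFrom1 n))
  where
  shiftˡ : ∀ x y → (1ℤ +ℤ x) - y ≡ 1ℤ +ℤ (x - y)
  shiftˡ = ℤ-solver.solve-∀
  shiftʳ : ∀ x y → x - (1ℤ +ℤ y) ≡ -1ℤ +ℤ (x - y)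
  shiftʳ = ℤ-solver.solve-∀
  evens odds′ : List (List ℕ) → ℕ
  evens L = length (filter (λ l → (P l ∧ isEven (length l)) Bool.≟ true) (filter (λ l → sum l ℕ.≟ n) L))
  odds′ L = length (filter (λ l → (P l ∧ not (isEven (length l))) Bool.≟ true) (filter (λ l → sum l ℕ.≟ n) L))
  go : ∀ L → + evens L - + odds′ L ≡ coef (signed P) L (+ n)
  go []      = refl
  -- The filter on ℕ and the integer test in `coef` both compute to this Boolean, so one split
  -- settles both.
  go (l ∷ L) with sum l ≡ᵇ n
  ... | false = trans (go L) (sym (ℤ.+-identityˡ _))
  ... | true rewrite sgn-length l | sym (go L) with P l | isEven (length l)
  ...   | false | _     = sym (ℤ.+-identityˡ _)
  ...   | true  | true  = trans (cong (λ x → x - + odds′ L) (ℤ.pos-+ 1 (evens L))) (shiftˡ (+ evens L) (+ odds′ L))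
  ...   | true  | false = trans (cong (λ y → + evens L - y) (ℤ.pos-+ 1 (odds′ L))) (shiftʳ (+ evens L) (+ odds′ L))

theorem6p1 : (n : ℕ) → (+ P4e n) - (+ P4o n) ≡ (+ S4e n) - (+ S4o n)
theorem6p1 n = begin
  + P4e n - + P4o n                                     ≡⟨ signed-count inP4 n ⟩
  coef (signed inP4) (sublists (downFrom1 n)) (+ n)     ≡⟨ coef-by-odds inP4 n ⟩
  sumBelow (suc n) (λ j → P.F j n (+ n))                ≡⟨ sumBelow-cong (suc n) (P-F≡S-F n) ⟩
  sumBelow (suc n) (λ j → S.F j n (+ n))                ≡⟨ coef-by-odds inS4 n ⟨
  coef (signed inS4) (sublists (downFrom1 n)) (+ n)     ≡⟨ signed-count inS4 n ⟨
  + S4e n - + S4o n                                     ∎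
  where open ≡-Reasoning
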